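{- Let $r>0$ be an integer and let $X=\{x_1,x_2,\dots,x_n\}$ be an order-type homogeneous set of points in $\mathbb{R}^d$. Then $$\left\lfloor\frac{n}{r}\right\rfloor - c(d,r) \le t(X,r)\leq \left\lfloor\frac{n}{r}\right\rfloor-\left\lfloor\frac{d}{2}\right\rfloor,$$ where $t(X,r)$ is the tolerance of $X$ and $c(d,r)$ is the number, defined in the context, that guarantees intersecting convex hulls for alternating partitions.
   Context: An ordered set $X=\{x_1,\dots,x_n\}\subset\mathbb{R}^d$ (ordered by the indices) is called order-type homogeneous if the orientation of any ordered subset of $X$ with $d+1$ elements is always the same; i.e. for all $i_1<\dots<i_{d+1}$ the determinant of the $(d+1)\times(d+1)$ matrix with columns $(1,x_{i_1}),\dots,(1,x_{i_{d+1}})$ has the same nonzero sign. For a finite set $X\subset\mathbb{R}^d$, the tolerance $t(X,r)$ is the maximum number of points such that there is a partition $A_1,\dots,A_r$ of $X$ with the property that $\bigcap_{i=1}^r\operatorname{conv}(A_i\setminus Y)\ne\emptyset$ for any $Y\subset X$ with at most $t(X,r)$ points. The alternating partition of an ordered set $X=\{x_1,\dots,x_n\}$ into $r$ sets $A_1,\dots,A_r$ is given by $A_i=\{x_j : j\equiv i \pmod r\}$. The number $c(d,r)$, depending only on $d$ and $r$, is such that for every order-type homogeneous set of $n\ge c(d,r)$ points in $\mathbb{R}^d$ the alternating partition $A_1,\dots,A_r$ satisfies $\bigcap_{i=1}^r \operatorname{conv}(A_i)\ne\emptyset$; such a number exists with $c(d,r)\le (d+1)(\lfloor d/2\rfloo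r+1)(r-1)+1$.
   Formalization: The upper bound is proved when d ≤ 3, or when r ≥ 2 and n > d, and only if t(X,r) exists (some r-partition has intersecting hulls); it fails as printed, e.g. for r = 1, d ≥ 4, where t(X,1) = n−1. If no such partition exists, t(X,r) is read as −1. -}

module Defs where

open import Algebra.Apartness.Bundles using (HeytingField; HeytingCommutativeRing)
open import Algebra.Bundles using (CommutativeRing; Semiring)
import Algebra.Definitions.RawSemiring as RawSemiringOps
import Algebra.Properties.CommutativeMonoid.Sum as Summation
open import Data.Fin as Fin using (Fin; zero; suc; toℕ; punchIn)
open import Data.Fin.Subset using (Subset; _∉_; _─_; ∣_∣)
open import Data.Integer as ℤ using (ℤ; +_)
open import Data.Nat as ℕ using (ℕ; zero; suc; NonZero)
open import Data.Nat.DivMod using (_mod_)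
open import Data.Product using (_×_; ∃-syntax)
open import Data.Sum using (_⊎_)
open import Data.Vec using (tabulate)
open import Function.Bundles using (_⇔_)
open import Function.Definitions using (Injective)
open import Level using (Level; _⊔_) renaming (suc to lsuc)
open import Relation.Binary.Core using (Rel)
open import Relation.Binary.PropositionalEquality using (_≡_)
open import Relation.Binary.Structures using (IsStrictPartialOrder)
open import Relation.Nullary using (¬_; does)

private
  variable
    c ℓ₁ ℓ₂ : Level
    d n r   : ℕ

-- The real numbers, given axiomatically as a Cauchy-complete Archimedean
-- ordered field.  Classically these axioms determine ℝ up to isomorphism.
-- They are phrased with an apartness relation, and without decidability of
-- the order, so that the constructive Cauchy reals satisfy them as well.
record Reals c ℓ₁ ℓ₂ : Set (lsuc (c ⊔ ℓ₁ ⊔ ℓ₂)) where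
  field
    heytingField : HeytingField c ℓ₁ ℓ₂

  open HeytingField heytingField public

  commutativeRing : CommutativeRing c ℓ₁
  commutativeRing = HeytingCommutativeRing.commutativeRing heytingCommutativeRing

  open RawSemiringOps (Semiring.rawSemiring (CommutativeRing.semiring commutativeRing)) public
    using (_^_) renaming (_×_ to _·_)
  open Summation (CommutativeRing.+-commutativeMonoid commutativeRing) public
    using (sum)

  infix 4 _<_ _≤_

  field
    _<_                    : Rel Carrier ℓ₂
    <-isStrictPartialOrder : IsStrictPartialOrder _≈_ _<_
    #⇔<⊎>                  : ∀ {x y} → x # y ⇔ (x < y ⊎ y < x)
    +-monoˡ-<              : ∀ {x y} z → x < y → x + z < y + z
    *-pos                  : ∀ {x y} → 0# < x → 0# < y → 0# < x * y

  _≤_ : Rel Carrier ℓ₂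
  x ≤ y = ¬ (y < x)

  IsCauchy : (ℕ → Carrier) → Set (c ⊔ ℓ₂)
  IsCauchy s = ∀ ε → 0# < ε →
    ∃[ N ] (∀ k m → N ℕ.≤ k → N ℕ.≤ m → s k - s m < ε)

  _ConvergesTo_ : (ℕ → Carrier) → Carrier → Set (c ⊔ ℓ₂)
  s ConvergesTo l = ∀ ε → 0# < ε →
    ∃[ N ] (∀ k → N ℕ.≤ k → (s k - l < ε) × (l - s k < ε))

  field
    archimedean    : ∀ x → ∃[ k ] (x < k · 1#)
    cauchyComplete : ∀ s → IsCauchy s → ∃[ l ] (s ConvergesTo l)

StrictlyIncreasing : ∀ {m n} → (Fin m → Fin n) → Set
StrictlyIncreasing ι = ∀ {a b} → a Fin.< b → ι a Fin.< ι b

-- A partition of the points into r (possibly empty) parts is encoded by the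
-- map sending the index of a point to the label of its part.
part : (Fin n → Fin r) → Fin r → Subset n
part f i = tabulate λ j → does (f j Fin.≟ i)

-- Points and parts are both numbered from 0 instead of 1, which leaves the
-- congruence between the two unchanged.
alternating : ∀ n r .{{_ : NonZero r}} → Fin n → Fin r
alternating n r j = toℕ j mod r

module _ (ℝ : Reals c ℓ₁ ℓ₂) where
  open Reals ℝ hiding (zero)

  Point : ℕ → Set c
  Point d = Fin d → Carrier

  SamePoint : Point d → Point d → Set ℓ₁
  SamePoint p q = ∀ a → p a ≈ q a

  -- Laplace expansion along the first row.
  det : (m : ℕ) → (Fin m → Fin m → Carrier) → Carrier
  det zero    M = 1#
  det (suc m) M =
    sum λ j → (- 1#) ^ toℕ j * (M zero j * det m λ a b → M (suc a) (punchIn j b))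

  -- The matrix with columns (1 , p₀) , … , (1 , p_d).
  orientationMatrix : (Fin (suc d) → Point d) → Fin (suc d) → Fin (suc d) → Carrier
  orientationMatrix p zero    j = 1#
  orientationMatrix p (suc a) j = p j a

  orientation : (Fin (suc d) → Point d) → Carrier
  orientation {d} p = det (suc d) (orientationMatrix p)

  -- The first component says that x enumerates a set: its points are distinct.
  OrderTypeHomogeneous : (Fin n → Point d) → Set (ℓ₁ ⊔ ℓ₂)
  OrderTypeHomogeneous {n} {d} x =
    Injective _≡_ SamePoint x ×
    ( (∀ (ι : Fin (suc d) → Fin n) → StrictlyIncreasing ι →
         0# < orientation (λ a → x (ι a)))
    ⊎ (∀ (ι : Fin (suc d) → Fin n) → StrictlyIncreasing ι →
         orientation (λ a → x (ι a)) < 0#) )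

  -- z is a convex combination of the points x i with i ∈ S.
  InConv : (Fin n → Point d) → Subset n → Point d → Set (c ⊔ ℓ₁ ⊔ ℓ₂)
  InConv {n} x S z = ∃[ w ]
    ( (∀ (i : Fin n) → 0# ≤ w i)
    × (∀ i → i ∉ S → w i ≈ 0#)
    × (sum w ≈ 1#)
    × (∀ a → z a ≈ sum (λ i → w i * x i a)) )

  HullsIntersect : (Fin n → Point d) → (Fin r → Subset n) → Set (c ⊔ ℓ₁ ⊔ ℓ₂)
  HullsIntersect {d = d} x A = ∃[ z ] (∀ i → InConv {d = d} x (A i) z)

  GuaranteesAlternating : (d r k : ℕ) .{{_ : NonZero r}} → Set (c ⊔ ℓ₁ ⊔ ℓ₂)
  GuaranteesAlternating d r k =
    ∀ n (x : Fin n → Point d) → OrderTypeHomogeneous x → k ℕ.≤ n →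
    HullsIntersect x (part (alternating n r))

  Tolerates : (Fin n → Point d) → ℕ → ℤ → Set (c ⊔ ℓ₁ ⊔ ℓ₂)
  Tolerates {n} x r t = ∃[ f ] (∀ (Y : Subset n) → + ∣ Y ∣ ℤ.≤ t →
    HullsIntersect {r = r} x (λ i → part f i ─ Y))

  -- t(X,r) = t.  The maximum is taken over ℤ, where negative t are tolerated
  -- vacuously (for r > 0): the value is -1 when X has no partition into r
  -- parts with intersecting convex hulls, and otherwise the maximum over ℕ.
  IsTolerance : (Fin n → Point d) → ℕ → ℤ → Set (c ⊔ ℓ₁ ⊔ ℓ₂)
  IsTolerance x r t = Tolerates x r t × (∀ s → Tolerates x r s → s ℤ.≤ t)

{-# OPTIONS --safe #-}
module Submission where

-- Lower bound: cut the sequence into ⌊n/r⌋ consecutive blocks of length r.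
-- Deleting Y spoils at most |Y| blocks, and the alternating partition of the
-- union of the unspoilt blocks is the restriction of that of X.
--
-- Upper bound: some part has at most ⌊n/r⌋ points, so if t were larger one
-- could delete all but a set S of at most ⌊d/2⌋ of them.  X is neighborly:
-- by Gale evenness, S lies on a hyperplane through d points of X that has all
-- other points strictly on one side.  A common point of conv S and of the hull
-- of another part would thus be an affine dependence among those d points,
-- which is impossible since they extend to d + 1 points of nonzero orientation.
-- For d ≤ 3 the small part can be deleted entirely, whatever r and n are.

open import Defs
open import Algebra.Apartness.Properties.HeytingCommutativeRing using (1#0; x#0y#0→xy#0)
open import Algebra.Bundles using (CommutativeRing; Semiring)
import Algebra.Definitions.RawSemiring as RawSemiringOps
import Algebra.Properties.AbelianGroup as AbelianGroupProperties
import Algebra.Properties.CommutativeMonoid.Sum as Summation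
import Algebra.Properties.CommutativeSemigroup as CommutativeSemigroupProperties
import Algebra.Properties.Group as GroupProperties
import Algebra.Properties.Ring as RingProperties
import Algebra.Properties.Semiring.Sum as SemiringSummation
open import Data.Bool.Base using (if_then_else_)
open import Data.Empty using (⊥-elim)
open import Data.Fin as Fin using (Fin; zero; suc; toℕ; punchIn; punchOut; lift; _↑ˡ_; _↑ʳ_)
import Data.Fin.Properties as Finₚ
open import Data.Fin.Subset using (Subset; inside; outside; _∈_; _∉_; _─_; ∣_∣)
open import Data.Fin.Subset.Properties using (_∈?_; p─q⊆p; ∣p∣≤∣x∷p∣)
open import Data.Integer as ℤ using (ℤ; +_)
import Data.Integer.Properties as ℤₚ
open import Data.Nat as ℕ using (ℕ; zero; suc; NonZero; _/_; _%_; ⌊_/2⌋; _≤_; _<_; z≤n; s≤s; s<s; z<s)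
open import Data.Nat.DivMod using ([m+n]%n≡m%n; m/n*n≤m; m≡m%n+[m/n]*n; m%n<n)
import Data.Nat.Properties as ℕₚ
open import Data.Product using (_×_; _,_; proj₁; proj₂; ∃-syntax)
open import Data.Sum using (_⊎_; inj₁; inj₂; [_,_]′)
open import Data.Unit.Polymorphic using (⊤; tt)
open import Data.Vec as Vec using (Vec; []; _∷_; _++_; tabulate; here; there)
open import Data.Vec.Properties using (lookup∘tabulate; []=⇒lookup; lookup⇒[]=; tabulate-cong)
open import Function using (_∘_; id)
open import Function.Bundles using (Equivalence)
open import Relation.Binary.Definitions using (tri<; tri≈; tri>)
open import Relation.Binary.PropositionalEquality as ≡ using (_≡_; _≢_; _≗_)
import Relation.Binary.Reasoning.Setoid as SetoidReasoning
open import Relation.Binary.Structures using (IsStrictPartialOrder)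
open import Relation.Nullary using (¬_; Dec; yes; no; does; contradiction)
open import Relation.Nullary.Decidable using (dec-true)

module Combinatorics where
  open import Data.Nat using (_+_; _*_)
  open ℕₚ
  open Summation +-0-commutativeMonoid using (sum; sum-cong-≗; ∑-distrib-+; sum-replicate-zero)
  open ≡ using (refl; sym; trans; cong; cong₂; subst; subst₂; module ≡-Reasoning)

  private
    variable
      d m n r : ℕ

  -- Increasing index sequences and Gale's evenness condition.

  lift-increasing : ∀ k {ι : Fin m → Fin n} → StrictlyIncreasing ι → StrictlyIncreasing (lift k ι)
  lift-increasing zero    inc                   = inc
  lift-increasing (suc k) inc {zero}  {suc b} _ = z<s
  lift-increasing (suc k) inc {suc a} {suc b} (s<s a<b) = s<s (lift-increasing k inc a<b)

  increasing⇒injective : {ι : Fin m → Fin n} → StrictlyIncreasing ι → ∀ {a b} → ι a ≡ ι b → a ≡ b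
  increasing⇒injective inc {a} {b} ιa≡ιb with Finₚ.<-cmp a b
  ... | tri≈ _ a≡b _ = a≡b
  ... | tri< a<b _ _ = contradiction ιa≡ιb (Finₚ.<⇒≢ (inc a<b))
  ... | tri> _ _ b<a = contradiction (sym ιa≡ιb) (Finₚ.<⇒≢ (inc b<a))

  InImage : (Fin d → Fin n) → Fin n → Set
  InImage ι i = ∃[ j ] ι j ≡ i

  -- `κ` merges `i` into `ι` in increasing order. At an even position, moving `i` to the front is an
  -- even permutation, so `i` followed by `ι` has the same orientation as the increasing sequence
  -- `κ`.
  record EvenInsertion (ι : Fin d → Fin n) (i : Fin n) : Set where
    field
      κ          : Fin (suc d) → Fin n
      increasing : StrictlyIncreasing κ
      position   : Fin (suc d)
      half       : ℕ
      even       : toℕ position ≡ half + half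
      inserted   : κ position ≡ i
      remaining  : κ ∘ punchIn position ≗ ι

  -- Gale's evenness condition: an even number of values of ι precede each
  -- non-value, so the hyperplane through the points indexed by ι has all other
  -- points on one side.
  record GaleFacet (S : Subset n) (d : ℕ) : Set where
    field
      ι          : Fin d → Fin n
      increasing : StrictlyIncreasing ι
      covers     : ∀ {i} → i ∈ S → InImage ι i
      evenly     : ∀ i → InImage ι i ⊎ EvenInsertion ι i
      spare      : d < n → ∃[ i ] EvenInsertion ι i

  wholeFacet : (S : Subset n) → GaleFacet S n
  wholeFacet S = record
    { ι          = id
    ; increasing = id
    ; covers     = λ {i} _ → i , refl
    ; evenly     = λ i → inj₁ (i , refl)
    ; spare      = λ n<n → contradiction n<n (<-irrefl refl)
    }

  -- The new index precedes all of `ι`, so it is inserted at position 0, and older insertions keep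
  -- their positions. It also serves as the `spare` index that later completes `ι` to `d + 1`
  -- indices.
  skipFirst : {S : Subset n} → GaleFacet S d → GaleFacet (outside ∷ S) d
  skipFirst {n} {d} {S} H = record
    { ι          = suc ∘ ι
    ; increasing = λ a<b → s<s (increasing a<b)
    ; covers     = λ { (there i∈S) → let j , eq = covers i∈S in j , cong suc eq }
    ; evenly     = evenly′
    ; spare      = λ _ → zero , first
    }
    where
    open GaleFacet H
    first : EvenInsertion (suc ∘ ι) zero
    first = record
      { κ = lift 1 ι ; increasing = lift-increasing 1 increasing
      ; position = zero ; half = 0 ; even = refl ; inserted = refl ; remaining = λ _ → refl }
    evenly′ : ∀ i → InImage (suc ∘ ι) i ⊎ EvenInsertion (suc ∘ ι) i
    evenly′ zero = inj₂ first
    evenly′ (suc i) with evenly i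
    ... | inj₁ (j , eq) = inj₁ (j , cong suc eq)
    ... | inj₂ e = inj₂ (record
      { κ = suc ∘ κ ; increasing = λ a<b → s<s (E.increasing a<b)
      ; position = position ; half = half ; even = even
      ; inserted = cong suc inserted ; remaining = cong suc ∘ remaining })
      where
      module E = EvenInsertion e
      open E using (κ; position; half; even; inserted; remaining)

  lift₂-insertion : {ι : Fin d → Fin n} {i : Fin n} →
                    EvenInsertion ι i → EvenInsertion (lift 2 ι) (suc (suc i))
  lift₂-insertion {ι = ι} e = record
    { κ = lift 2 κ ; increasing = lift-increasing 2 increasing
    ; position = suc (suc position) ; half = suc half
    ; even = cong suc (trans (cong suc even) (sym (+-suc half half)))
    ; inserted = cong (λ i → suc (suc i)) inserted ; remaining = remaining′ }
    where
    open EvenInsertion e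
    remaining′ : lift 2 κ ∘ punchIn (suc (suc position)) ≗ lift 2 ι
    remaining′ zero          = refl
    remaining′ (suc zero)    = refl
    remaining′ (suc (suc b)) = cong (λ i → suc (suc i)) (remaining b)

  -- Two consecutive indices enter together, so every later insertion moves by two positions and
  -- stays even. The second index is taken whether or not it lies in the set.
  takePair : ∀ {s t} {S : Subset n} → GaleFacet S d → GaleFacet (s ∷ t ∷ S) (2 + d)
  takePair {n} {d} {s} {t} {S} H = record
    { ι          = lift 2 ι
    ; increasing = lift-increasing 2 increasing
    ; covers     = λ { {zero} _ → zero , refl
                     ; {suc zero} _ → suc zero , refl
                     ; {suc (suc i)} (there (there i∈S)) →
                         let j , eq = covers i∈S in suc (suc j) , cong (λ i → suc (suc i)) eq }
    ; evenly     = evenly′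
    ; spare      = λ { (s<s (s<s d<n)) → let i , e = spare d<n in suc (suc i) , lift₂-insertion e }
    }
    where
    open GaleFacet H
    evenly′ : ∀ i → InImage (lift 2 ι) i ⊎ EvenInsertion (lift 2 ι) i
    evenly′ zero       = inj₁ (zero , refl)
    evenly′ (suc zero) = inj₁ (suc zero , refl)
    evenly′ (suc (suc i)) with evenly i
    ... | inj₁ (j , eq) = inj₁ (suc (suc j) , cong (λ i → suc (suc i)) eq)
    ... | inj₂ e        = inj₂ (lift₂-insertion e)

  -- Greedy scan from the left: a first index outside `S` is skipped; one inside uses up two places
  -- of `d` and at least one element of `S`, which preserves the bound. Once `d = n` all remaining
  -- indices are taken.
  galeFacet : ∀ d (S : Subset n) → ∣ S ∣ + ∣ S ∣ ≤ d → d ≤ n → GaleFacet S d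
  galeFacet d S 2∣S∣≤d d≤n with m≤n⇒m<n∨m≡n d≤n
  galeFacet d S 2∣S∣≤d d≤n | inj₂ refl = wholeFacet S
  galeFacet d (outside ∷ S) 2∣S∣≤d d≤n | inj₁ (s≤s d≤n′) = skipFirst (galeFacet d S 2∣S∣≤d d≤n′)
  -- A nonempty `S` needs two places, so one place is too few.
  galeFacet (suc zero) (inside ∷ S) (s≤s 2∣S∣≤d) _ | inj₁ _ =
    contradiction (subst (_≤ 0) (+-suc ∣ S ∣ ∣ S ∣) 2∣S∣≤d) λ ()
  galeFacet (suc (suc d)) (inside ∷ t ∷ S) (s≤s 2∣S∣≤d) (s≤s (s≤s d≤n)) | inj₁ _ =
    takePair (galeFacet d S bound d≤n)
    where
    bound : ∣ S ∣ + ∣ S ∣ ≤ d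
    bound = ≤-trans (+-mono-≤ (∣p∣≤∣x∷p∣ t S) (∣p∣≤∣x∷p∣ t S))
                    (ℕ.s≤s⁻¹ (subst (_≤ suc d) (+-suc ∣ t ∷ S ∣ ∣ t ∷ S ∣) 2∣S∣≤d))

  -- Parts of a partition, deletion and pigeonhole.

  ∈-part⁺ : ∀ (f : Fin n → Fin r) {i} {j} → f j ≡ i → j ∈ part f i
  ∈-part⁺ f {i} {j} fj≡i =
    lookup⇒[]= j (part f i) (trans (lookup∘tabulate _ j) (dec-true (f j Fin.≟ i) fj≡i))

  ∈-part⁻ : ∀ (f : Fin n → Fin r) {i} {j} → j ∈ part f i → f j ≡ i
  ∈-part⁻ f {i} {j} j∈ with f j Fin.≟ i | trans (sym (lookup∘tabulate (λ j → does (f j Fin.≟ i)) j)) ([]=⇒lookup j∈)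
  ... | yes fj≡i | _ = fj≡i
  ... | no  _    | ()

  ∈-─⁺ : ∀ {p q : Subset n} {i} → i ∈ p → i ∉ q → i ∈ p ─ q
  ∈-─⁺ {p = _ ∷ _} {outside ∷ q} here        _   = here
  ∈-─⁺ {p = _ ∷ _} {inside  ∷ q} here        i∉q = contradiction here i∉q
  ∈-─⁺ {p = _ ∷ _} {outside ∷ q} (there i∈p) i∉q = there (∈-─⁺ i∈p (i∉q ∘ there))
  ∈-─⁺ {p = _ ∷ _} {inside  ∷ q} (there i∈p) i∉q = there (∈-─⁺ i∈p (i∉q ∘ there))

  -- Elements of `A` go into `Y` while the allowance `t` lasts; those met afterwards are charged to
  -- `m`.
  discard : ∀ t (A : Subset n) → ∣ A ∣ ≤ t + m → ∃[ Y ] ∣ Y ∣ ≤ t × ∣ A ─ Y ∣ ≤ m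
  discard t [] _ = [] , z≤n , z≤n
  discard t (outside ∷ A) ∣A∣≤ =
    let Y , ∣Y∣≤t , rest = discard t A ∣A∣≤ in outside ∷ Y , ∣Y∣≤t , rest
  discard {m = suc m} zero (inside ∷ A) (s≤s ∣A∣≤) =
    let Y , ∣Y∣≤t , rest = discard zero A ∣A∣≤ in outside ∷ Y , ∣Y∣≤t , s≤s rest
  discard (suc t) (inside ∷ A) (s≤s ∣A∣≤) =
    let Y , ∣Y∣≤t , rest = discard t A ∣A∣≤ in inside ∷ Y , s≤s ∣Y∣≤t , rest

  -- The cardinality of the one-entry vector `does P? ∷ []` acts as the 0-1 indicator of `P`.
  ∣∷∣ : ∀ {P : Set} (P? : Dec P) (p : Subset n) → ∣ does P? ∷ p ∣ ≡ ∣ does P? ∷ [] ∣ + ∣ p ∣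
  ∣∷∣ (yes _) p = refl
  ∣∷∣ (no _)  p = refl

  sum-indicator : (i : Fin r) → sum (λ k → ∣ does (i Fin.≟ k) ∷ [] ∣) ≡ 1
  sum-indicator {suc r} zero    = cong suc (sum-replicate-zero r)
  sum-indicator         (suc i) = sum-indicator i

  sum-∣part∣ : (f : Fin n → Fin r) → sum (λ k → ∣ part f k ∣) ≡ n
  sum-∣part∣ {zero}  {r} f = sum-replicate-zero r
  sum-∣part∣ {suc n} {r} f = begin
    sum (λ k → ∣ part f k ∣)
      ≡⟨ sum-cong-≗ (λ k → ∣∷∣ (f zero Fin.≟ k) (part (f ∘ suc) k)) ⟩
    sum (λ k → ∣ does (f zero Fin.≟ k) ∷ [] ∣ + ∣ part (f ∘ suc) k ∣)
      ≡⟨ ∑-distrib-+ {r} (λ k → ∣ does (f zero Fin.≟ k) ∷ [] ∣) (λ k → ∣ part (f ∘ suc) k ∣) ⟩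
    sum (λ k → ∣ does (f zero Fin.≟ k) ∷ [] ∣) + sum (λ k → ∣ part (f ∘ suc) k ∣)
      ≡⟨ cong₂ _+_ (sum-indicator (f zero)) (sum-∣part∣ (f ∘ suc)) ⟩
    suc n ∎
    where open ≡-Reasoning

  *-≤-sum : ∀ {b} (g : Fin r → ℕ) → (∀ k → b ≤ g k) → r * b ≤ sum g
  *-≤-sum {zero}  g b≤g = z≤n
  *-≤-sum {suc r} g b≤g = +-mono-≤ (b≤g zero) (*-≤-sum (g ∘ suc) (b≤g ∘ suc))

  n<r*[1+n/r] : ∀ n r .{{_ : NonZero r}} → n < r * suc (n / r)
  n<r*[1+n/r] n r = begin-strict
    n                     ≡⟨ m≡m%n+[m/n]*n n r ⟩
    n % r + n / r * r     <⟨ +-monoˡ-< (n / r * r) (m%n<n n r) ⟩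
    suc (n / r) * r       ≡⟨ *-comm (suc (n / r)) r ⟩
    r * suc (n / r)       ∎
    where open ≤-Reasoning

  -- Pigeonhole: if every part exceeded `n / r`, the parts would have at least `r * suc (n / r)`
  -- points together, more than `n`.
  smallPart : ∀ n r .{{_ : NonZero r}} (f : Fin n → Fin r) → ∃[ k ] ∣ part f k ∣ ≤ n / r
  smallPart n r f with Finₚ.any? (λ k → ∣ part f k ∣ ≤? n / r)
  ... | yes found = found
  ... | no  none  = contradiction
    (subst (r * suc (n / r) ≤_) (sum-∣part∣ f) (*-≤-sum (λ k → ∣ part f k ∣) λ k → ≰⇒> λ ≤q → none (k , ≤q)))
    (<⇒≱ (n<r*[1+n/r] n r))

  -- Unspoilt blocks and residues modulo `r`.

  record AlignedAvoiding (r n q : ℕ) .{{_ : NonZero r}} (Y : Subset n) : Set where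
    field
      blocks     : ℕ
      -- Additive form of a lower bound on `blocks`: each deleted point spoils at most one block.
      enough     : q ≤ blocks + ∣ Y ∣
      e          : Fin (blocks * r) → Fin n
      increasing : StrictlyIncreasing e
      avoids     : ∀ j → e j ∉ Y
      -- Equal residues put `j` and `e j` into equally numbered parts of the two alternating
      -- partitions.
      aligned    : ∀ j → toℕ (e j) % r ≡ toℕ j % r

  ∈-++ʳ⁻ : ∀ (p : Subset m) {q : Subset n} {i} → m ↑ʳ i ∈ p ++ q → i ∈ q
  ∈-++ʳ⁻ []      i∈         = i∈
  ∈-++ʳ⁻ (_ ∷ p) (there i∈) = ∈-++ʳ⁻ p i∈

  ∈-++ˡ⁻ : ∀ (p : Subset m) {q : Subset n} {i} → i ↑ˡ n ∈ p ++ q → i ∈ p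
  ∈-++ˡ⁻ (_ ∷ p) {i = zero}  here       = here
  ∈-++ˡ⁻ (_ ∷ p) {i = suc i} (there i∈) = there (∈-++ˡ⁻ p i∈)

  ∣++∣ : ∀ (p : Subset m) (q : Subset n) → ∣ p ++ q ∣ ≡ ∣ p ∣ + ∣ q ∣
  ∣++∣ []            q = refl
  ∣++∣ (inside  ∷ p) q = cong suc (∣++∣ p q)
  ∣++∣ (outside ∷ p) q = ∣++∣ p q

  ∣p∣≡0⇒∉ : ∀ (p : Subset n) → ∣ p ∣ ≡ 0 → ∀ i → i ∉ p
  ∣p∣≡0⇒∉ (outside ∷ p) ∣p∣≡0 (suc i) (there i∈p) = ∣p∣≡0⇒∉ p ∣p∣≡0 i i∈p

  [r+j]%r : ∀ r .{{_ : NonZero r}} j → (r + j) % r ≡ j % r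
  [r+j]%r r j = trans (cong (_% r) (+-comm r j)) ([m+n]%n≡m%n j r)

  -- Recursion over the blocks, with `Y₁` and `Y₂` the traces of `Y` on the first block and on the
  -- rest. All shifts are by the block length `r`, so residues do not change.
  alignedAvoiding : ∀ r .{{_ : NonZero r}} q (Y : Subset n) → q * r ≤ n → AlignedAvoiding r n q Y
  alignedAvoiding r zero Y _ = record
    { blocks = 0 ; enough = z≤n ; e = λ () ; increasing = λ {} ; avoids = λ () ; aligned = λ () }
  alignedAvoiding {n} r (suc q) Y qr≤n with m≤n⇒∃[o]m+o≡n (≤-trans (m≤m+n r (q * r)) qr≤n)
  ... | n′ , refl with Vec.splitAt r Y
  ... | Y₁ , Y₂ , refl with alignedAvoiding r q Y₂ (+-cancelˡ-≤ r (q * r) n′ qr≤n)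
  ... | rest with ∣ Y₁ ∣ in ∣Y₁∣
  -- A spoilt block is skipped; a deleted point inside it pays for the loss in `enough`.
  ... | suc k = record
    { blocks     = blocks
    ; enough     = begin
        suc q                                  ≤⟨ s≤s enough ⟩
        suc (blocks + ∣ Y₂ ∣)                  ≡⟨ +-suc blocks ∣ Y₂ ∣ ⟨
        blocks + suc ∣ Y₂ ∣                    ≤⟨ +-monoʳ-≤ blocks (s≤s (m≤n+m ∣ Y₂ ∣ k)) ⟩
        blocks + (suc k + ∣ Y₂ ∣)              ≡⟨ cong (λ l → blocks + (l + ∣ Y₂ ∣)) ∣Y₁∣ ⟨
        blocks + (∣ Y₁ ∣ + ∣ Y₂ ∣)             ≡⟨ cong (_+_ blocks) (∣++∣ Y₁ Y₂) ⟨
        blocks + ∣ Y₁ ++ Y₂ ∣                  ∎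
    ; e          = λ j → r ↑ʳ e j
    ; increasing = λ a<b → subst₂ _<_ (sym (Finₚ.toℕ-↑ʳ r _)) (sym (Finₚ.toℕ-↑ʳ r _)) (+-monoʳ-< r (increasing a<b))
    ; avoids     = λ j → avoids j ∘ ∈-++ʳ⁻ Y₁
    ; aligned    = λ j → trans (cong (_% r) (Finₚ.toℕ-↑ʳ r (e j))) (trans ([r+j]%r r _) (aligned j))
    }
    where
    open AlignedAvoiding rest
    open ≤-Reasoning
  -- A block free of `Y` is kept whole, in front of the blocks found in the rest.
  ... | zero = record
    { blocks     = suc blocks
    ; enough     = s≤s (≤-trans enough (+-monoʳ-≤ blocks (≤-trans (m≤n+m ∣ Y₂ ∣ ∣ Y₁ ∣) (≤-reflexive (sym (∣++∣ Y₁ Y₂))))))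
    ; e          = e′
    ; increasing = λ {a} {b} → increasing′ a b
    ; avoids     = avoids′
    ; aligned    = aligned′
    }
    where
    open AlignedAvoiding rest
    e₊ : Fin r ⊎ Fin (blocks * r) → Fin (r + n′)
    e₊ (inj₁ j) = j ↑ˡ n′
    e₊ (inj₂ j) = r ↑ʳ e j
    e′ : Fin (r + blocks * r) → Fin (r + n′)
    e′ j = e₊ (Fin.splitAt r j)
    -- Stated on the sum type, with the order read through `join`, so that only the four
    -- combinations of first block and rest remain.
    e₊-increasing : ∀ s t → Fin.join r (blocks * r) s Fin.< Fin.join r (blocks * r) t → e₊ s Fin.< e₊ t
    e₊-increasing (inj₁ a) (inj₁ b) lt =
      subst₂ _<_ (trans (Finₚ.toℕ-↑ˡ a (blocks * r)) (sym (Finₚ.toℕ-↑ˡ a n′)))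
                 (trans (Finₚ.toℕ-↑ˡ b (blocks * r)) (sym (Finₚ.toℕ-↑ˡ b n′))) lt
    e₊-increasing (inj₁ a) (inj₂ b) _ =
      subst₂ _<_ (sym (Finₚ.toℕ-↑ˡ a n′)) (sym (Finₚ.toℕ-↑ʳ r (e b)))
        (<-≤-trans (Finₚ.toℕ<n a) (m≤m+n r _))
    e₊-increasing (inj₂ a) (inj₁ b) lt = contradiction
      (subst₂ _<_ (Finₚ.toℕ-↑ʳ r a) (Finₚ.toℕ-↑ˡ b (blocks * r)) lt)
      (<⇒≯ (<-≤-trans (Finₚ.toℕ<n b) (m≤m+n r _)))
    e₊-increasing (inj₂ a) (inj₂ b) lt =
      subst₂ _<_ (sym (Finₚ.toℕ-↑ʳ r (e a))) (sym (Finₚ.toℕ-↑ʳ r (e b)))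
        (+-monoʳ-< r (increasing (+-cancelˡ-< r _ _
          (subst₂ _<_ (Finₚ.toℕ-↑ʳ r a) (Finₚ.toℕ-↑ʳ r b) lt))))
    increasing′ : ∀ a b → a Fin.< b → e′ a Fin.< e′ b
    increasing′ a b a<b = e₊-increasing (Fin.splitAt r a) (Fin.splitAt r b)
      (subst₂ Fin._<_ (sym (Finₚ.join-splitAt r (blocks * r) a)) (sym (Finₚ.join-splitAt r (blocks * r) b)) a<b)
    avoids′ : ∀ j → e′ j ∉ Y₁ ++ Y₂
    avoids′ j with Fin.splitAt r j
    ... | inj₁ i = ∣p∣≡0⇒∉ Y₁ ∣Y₁∣ i ∘ ∈-++ˡ⁻ Y₁
    ... | inj₂ i = avoids i ∘ ∈-++ʳ⁻ Y₁
    e₊-aligned : ∀ s → toℕ (e₊ s) % r ≡ toℕ (Fin.join r (blocks * r) s) % r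
    e₊-aligned (inj₁ i) = cong (_% r) (trans (Finₚ.toℕ-↑ˡ i n′) (sym (Finₚ.toℕ-↑ˡ i (blocks * r))))
    e₊-aligned (inj₂ i) = begin
      toℕ (r ↑ʳ e i) % r   ≡⟨ cong (_% r) (Finₚ.toℕ-↑ʳ r (e i)) ⟩
      (r + toℕ (e i)) % r  ≡⟨ [r+j]%r r _ ⟩
      toℕ (e i) % r        ≡⟨ aligned i ⟩
      toℕ i % r            ≡⟨ [r+j]%r r _ ⟨
      (r + toℕ i) % r      ≡⟨ cong (_% r) (Finₚ.toℕ-↑ʳ r i) ⟨
      toℕ (r ↑ʳ i) % r     ∎
      where open ≡-Reasoning
    aligned′ : ∀ j → toℕ (e′ j) % r ≡ toℕ j % r
    aligned′ j = trans (e₊-aligned (Fin.splitAt r j))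
                       (cong (λ i → toℕ i % r) (Finₚ.join-splitAt r (blocks * r) j))

  alternating-aligned : ∀ {m n} r .{{_ : NonZero r}} {i : Fin m} {j : Fin n} →
                        toℕ i % r ≡ toℕ j % r → alternating m r i ≡ alternating n r j
  alternating-aligned r {i} {j} eq = Finₚ.fromℕ<-cong _ _ eq (m%n<n (toℕ i) r) (m%n<n (toℕ j) r)

open Combinatorics

-- Determinants as antisymmetric forms over a commutative ring.

module ExteriorAlgebra {c ℓ} (R : CommutativeRing c ℓ) where
  open CommutativeRing R hiding (zero)
  open RawSemiringOps (Semiring.rawSemiring semiring) using (_^_)
  open Summation +-commutativeMonoid using (sum; sum-cong-≋; sum-replicate-zero; ∑-distrib-+)
  open SemiringSummation semiring using (*-distribˡ-sum)
  open AbelianGroupProperties +-abelianGroup using (⁻¹-anti-homo‿-; ⁻¹-∙-comm)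
  open GroupProperties +-group using () renaming (ε⁻¹≈ε to -0≈0; ⁻¹-involutive to -‿involutive)
  open RingProperties ring using (-‿distribʳ-*; -1*x≈-x)
  open CommutativeSemigroupProperties *-commutativeSemigroup using (x∙yz≈y∙xz)
  open SetoidReasoning setoid

  private
    variable
      A : Set
      m n : ℕ

  -‿cong₂ : ∀ {x x′ y y′} → x ≈ x′ → y ≈ y′ → x - y ≈ x′ - y′
  -‿cong₂ x≈ y≈ = +-cong x≈ (-‿cong y≈)

  -‿negated : ∀ {x x′ y y′} → x ≈ - x′ → y ≈ - y′ → x - y ≈ - (x′ - y′)
  -‿negated {x} {x′} {y} {y′} x≈ y≈ = begin
    x - y         ≈⟨ -‿cong₂ x≈ y≈ ⟩
    - x′ - (- y′) ≈⟨ ⁻¹-∙-comm x′ (- y′) ⟩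
    - (x′ - y′)   ∎

  -- Laplace expansion, peeling off one column at a time: linearity and
  -- antisymmetry are then inherited from G by induction, without punchIn.
  wedge : (Vec A m → Carrier) → (A → Carrier) → Vec A (suc m) → Carrier
  wedge {m = zero}  G f (x ∷ c) = f x * G c
  wedge {m = suc m} G f (x ∷ c) = f x * G c - wedge (λ c′ → G (x ∷ c′)) f c

  -- The determinant with entries `φ a (c b)`: rows are functions on labels, columns are a list of
  -- labels.
  detForm : ∀ m → (Fin m → A → Carrier) → Vec A m → Carrier
  detForm zero    φ _ = 1#
  detForm (suc m) φ   = wedge (detForm m (φ ∘ suc)) (φ zero)

  wedge-negated : ∀ {G H : Vec A m → Carrier} f → (∀ c → G c ≈ - H c) →
                  ∀ c → wedge G f c ≈ - wedge H f c
  wedge-negated {m = zero}  f G≈ (x ∷ c) = trans (*-congˡ (G≈ c)) (sym (-‿distribʳ-* _ _))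
  wedge-negated {m = suc m} f G≈ (x ∷ c) =
    -‿negated (trans (*-congˡ (G≈ c)) (sym (-‿distribʳ-* _ _)))
              (wedge-negated f (λ c′ → G≈ (x ∷ c′)) c)

  -- Each peeled column contributes one minus sign; these accumulate to the sign in the Laplace
  -- expansion that defines `det`.
  wedge-expand : ∀ (G : Vec A m → Carrier) f (c : Fin (suc m) → A) →
    wedge G f (tabulate c) ≈
    sum λ j → (- 1#) ^ toℕ j * (f (c j) * G (tabulate (c ∘ punchIn j)))
  wedge-expand {m = zero} G f c = begin
    f (c zero) * G []                ≈⟨ *-identityˡ _ ⟨
    1# * (f (c zero) * G [])         ≈⟨ +-identityʳ _ ⟨
    1# * (f (c zero) * G []) + 0#    ∎
  wedge-expand {m = suc m} G f c = +-cong (sym (*-identityˡ _)) (begin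
    - wedge G₀ f (tabulate (c ∘ suc))   ≈⟨ -‿cong (wedge-expand G₀ f (c ∘ suc)) ⟩
    - sum t                             ≈⟨ -1*x≈-x _ ⟨
    - 1# * sum t                        ≈⟨ *-distribˡ-sum (- 1#) t ⟩
    sum (λ j → - 1# * t j)              ≈⟨ sum-cong-≋ {suc m} (λ j → sym (*-assoc (- 1#) ((- 1#) ^ toℕ j) (b j))) ⟩
    sum (λ j → - 1# * (- 1#) ^ toℕ j * b j) ∎)
    where
    G₀ : Vec _ m → Carrier
    G₀ c′ = G (c zero ∷ c′)
    b t : Fin (suc m) → Carrier
    b j = f (c (suc j)) * G₀ (tabulate (c ∘ suc ∘ punchIn j))
    t j = (- 1#) ^ toℕ j * b j

  -- Only adjacent transpositions are recorded: that of the first two entries, and recursively those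
  -- behind a fixed head. They generate all permutations, and this form suits induction on vectors.
  Antisymmetric : (Vec A m → Carrier) → Set ℓ
  Antisymmetric {m = zero}        G = ⊤
  Antisymmetric {m = suc zero}    G = ⊤
  Antisymmetric {m = suc (suc m)} G =
    (∀ x y c → G (x ∷ y ∷ c) ≈ - G (y ∷ x ∷ c)) × (∀ x → Antisymmetric λ c → G (x ∷ c))

  fixFirst : {G : Vec A (suc m) → Carrier} → Antisymmetric G → ∀ x → Antisymmetric λ c → G (x ∷ c)
  fixFirst {m = zero}  _         x = tt
  fixFirst {m = suc m} (_ , alt) x = alt x

  -- `a * G c - H c` is the shape of a `wedge` whose first entry is fixed.
  antisymmetric-difference : ∀ a {G H : Vec A m → Carrier} → Antisymmetric G → Antisymmetric H →
                    Antisymmetric λ c → a * G c - H c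
  antisymmetric-difference {m = zero}        a _ _ = tt
  antisymmetric-difference {m = suc zero}    a _ _ = tt
  antisymmetric-difference {m = suc (suc m)} a (swapG , altG) (swapH , altH) =
    (λ x y c → -‿negated (trans (*-congˡ (swapG x y c)) (sym (-‿distribʳ-* _ _))) (swapH x y c)) ,
    (λ x → antisymmetric-difference a (altG x) (altH x))

  wedge-antisymmetric : ∀ {G : Vec A m → Carrier} f → Antisymmetric G → Antisymmetric (wedge G f)
  wedge-antisymmetric {m = zero}                  f _    = tt
  wedge-antisymmetric {m = suc m}       {G = G} f altG =
    swap altG ,
    λ x → antisymmetric-difference (f x) altG (wedge-antisymmetric f (fixFirst altG x))
    where
    swap : ∀ {m} {G : Vec _ (suc m) → Carrier} → Antisymmetric G →
           ∀ x y c → wedge G f (x ∷ y ∷ c) ≈ - wedge G f (y ∷ x ∷ c)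
    swap {zero}      _           x y [] = sym (⁻¹-anti-homo‿- _ _)
    -- `P` and `Q` belong to the two leading columns and trade places under the swap; the remainder
    -- `L` changes sign because `G` does.
    swap {suc m} {G} (swapG , _) x y c = begin
      P - (Q - L x y)    ≈⟨ +-congˡ (⁻¹-anti-homo‿- Q (L x y)) ⟩
      P + (L x y - Q)    ≈⟨ +-congˡ (+-congʳ (wedge-negated f (λ c′ → swapG x y c′) c)) ⟩
      P + (- L y x - Q)  ≈⟨ +-assoc P (- L y x) (- Q) ⟨
      P - L y x - Q      ≈⟨ ⁻¹-anti-homo‿- Q (P - L y x) ⟨
      - (Q - (P - L y x)) ∎
      where
      P = f x * G (y ∷ c)
      Q = f y * G (x ∷ c)
      L : _ → _ → Carrier
      L a b = wedge (λ c′ → G (a ∷ b ∷ c′)) f c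

  detForm-antisymmetric : ∀ m (φ : Fin m → A → Carrier) → Antisymmetric (detForm m φ)
  detForm-antisymmetric zero    φ = tt
  detForm-antisymmetric (suc m) φ = wedge-antisymmetric (φ zero) (detForm-antisymmetric m (φ ∘ suc))

  -- The entry `c p` passes the `p` entries before it, at the cost of one sign each.
  moveToFront : {G : Vec A (suc m) → Carrier} → Antisymmetric G → ∀ c p →
    G (c p ∷ tabulate (c ∘ punchIn p)) ≈ (- 1#) ^ toℕ p * G (tabulate c)
  moveToFront                 _            c zero    = sym (*-identityˡ _)
  moveToFront {m = suc m} {G} (swap , alt) c (suc p) = begin
    G (c (suc p) ∷ c zero ∷ tabulate (c ∘ suc ∘ punchIn p))   ≈⟨ swap _ _ _ ⟩
    - G (c zero ∷ c (suc p) ∷ tabulate (c ∘ suc ∘ punchIn p)) ≈⟨ -‿cong (moveToFront (alt (c zero)) (c ∘ suc) p) ⟩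
    - ((- 1#) ^ toℕ p * G (tabulate c))                       ≈⟨ -1*x≈-x _ ⟨
    - 1# * ((- 1#) ^ toℕ p * G (tabulate c))                  ≈⟨ *-assoc _ _ _ ⟨
    - 1# * (- 1#) ^ toℕ p * G (tabulate c)                    ∎

  -- The leading copy travels inward by swaps until it stands next to `c j`; exchanging the two
  -- equal entries then makes the value its own negative.
  repeated : (∀ {x} → x ≈ - x → x ≈ 0#) → {G : Vec A (suc m) → Carrier} → Antisymmetric G →
             ∀ c j → G (c j ∷ tabulate c) ≈ 0#
  repeated torsionFree {G} (swap , _)   c zero    = torsionFree (swap _ _ _)
  repeated torsionFree {G} (swap , alt) c (suc j) = begin
    G (c (suc j) ∷ tabulate c)                          ≈⟨ swap _ _ _ ⟩
    - G (c zero ∷ c (suc j) ∷ tabulate (c ∘ suc))       ≈⟨ -‿cong (repeated torsionFree (alt (c zero)) (c ∘ suc) j) ⟩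
    - 0#                                                ≈⟨ -0≈0 ⟩
    0#                                                  ∎

  -1^even≈1 : ∀ k → (- 1#) ^ (k ℕ.+ k) ≈ 1#
  -1^even≈1 zero    = refl
  -1^even≈1 (suc k) rewrite ℕₚ.+-suc k k = begin
    - 1# * (- 1# * (- 1#) ^ (k ℕ.+ k)) ≈⟨ -1*x≈-x _ ⟩
    - (- 1# * (- 1#) ^ (k ℕ.+ k))      ≈⟨ -‿cong (-1*x≈-x _) ⟩
    - (- ((- 1#) ^ (k ℕ.+ k)))         ≈⟨ -‿involutive _ ⟩
    (- 1#) ^ (k ℕ.+ k)                 ≈⟨ -1^even≈1 k ⟩
    1#                                 ∎

  sum-zero : (f : Fin n → Carrier) → (∀ i → f i ≈ 0#) → sum f ≈ 0#
  sum-zero {n} f f≈0 = trans (sum-cong-≋ f≈0) (sum-replicate-zero n)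

  sum-single : (f : Fin n → Carrier) (s : Fin n) → (∀ i → i ≢ s → f i ≈ 0#) → sum f ≈ f s
  sum-single f zero    f≈0 = trans (+-congˡ (sum-zero (f ∘ suc) λ i → f≈0 (suc i) λ ())) (+-identityʳ _)
  sum-single f (suc s) f≈0 =
    trans (+-cong (f≈0 zero λ ()) (sum-single (f ∘ suc) s λ i i≢s → f≈0 (suc i) (i≢s ∘ Finₚ.suc-injective)))
          (+-identityˡ _)

  -- Pairing weights with functions.

  infix 8 ⟨_,_⟩
  ⟨_,_⟩ : (Fin n → Carrier) → (Fin n → Carrier) → Carrier
  ⟨ w , g ⟩ = sum λ i → w i * g i

  ⟨⟩-congʳ : ∀ (w : Fin n → Carrier) {g h} → (∀ i → g i ≈ h i) → ⟨ w , g ⟩ ≈ ⟨ w , h ⟩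
  ⟨⟩-congʳ w g≈h = sum-cong-≋ λ i → *-congˡ (g≈h i)

  ⟨⟩-scale : ∀ (w : Fin n → Carrier) a g → ⟨ w , (λ i → a * g i) ⟩ ≈ a * ⟨ w , g ⟩
  ⟨⟩-scale w a g = begin
    ⟨ w , (λ i → a * g i) ⟩     ≈⟨ sum-cong-≋ (λ i → x∙yz≈y∙xz (w i) a (g i)) ⟩
    sum (λ i → a * (w i * g i)) ≈⟨ *-distribˡ-sum a (λ i → w i * g i) ⟨
    a * ⟨ w , g ⟩               ∎

  ⟨⟩-+ : ∀ (w : Fin n → Carrier) g h → ⟨ w , (λ i → g i + h i) ⟩ ≈ ⟨ w , g ⟩ + ⟨ w , h ⟩
  ⟨⟩-+ w g h = trans (sum-cong-≋ λ i → distribˡ (w i) (g i) (h i)) (∑-distrib-+ (λ i → w i * g i) (λ i → w i * h i))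

  ⟨⟩-neg : ∀ (w : Fin n → Carrier) g → ⟨ w , (λ i → - g i) ⟩ ≈ - ⟨ w , g ⟩
  ⟨⟩-neg w g = begin
    ⟨ w , (λ i → - g i) ⟩       ≈⟨ ⟨⟩-congʳ w (λ i → sym (-1*x≈-x (g i))) ⟩
    ⟨ w , (λ i → - 1# * g i) ⟩  ≈⟨ ⟨⟩-scale w (- 1#) g ⟩
    - 1# * ⟨ w , g ⟩            ≈⟨ -1*x≈-x _ ⟩
    - ⟨ w , g ⟩                 ∎

  module _ (u v : Fin n → Carrier) where

    -- If `u` and `v` represent the same point as convex combinations, every affine functional of
    -- the points is balanced. The lemmas that follow close the notion under linear combinations.
    Balanced : (Fin n → Carrier) → Set ℓ
    Balanced g = ⟨ u , g ⟩ ≈ ⟨ v , g ⟩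

    balanced-scale : ∀ a {g} → Balanced g → Balanced λ i → a * g i
    balanced-scale a {g} b = trans (⟨⟩-scale u a g) (trans (*-congˡ b) (sym (⟨⟩-scale v a g)))

    balanced-cong : ∀ {g h} → (∀ i → g i ≈ h i) → Balanced g → Balanced h
    balanced-cong g≈h b = trans (sym (⟨⟩-congʳ u g≈h)) (trans b (⟨⟩-congʳ v g≈h))

    balanced-neg : ∀ {g} → Balanced g → Balanced λ i → - g i
    balanced-neg {g} b = trans (⟨⟩-neg u g) (trans (-‿cong b) (sym (⟨⟩-neg v g)))

    balanced-difference : ∀ {g h} → Balanced g → Balanced h → Balanced λ i → g i - h i
    balanced-difference {g} {h} b b′ =
      trans (⟨⟩-+ u g _) (trans (+-cong b (balanced-neg b′)) (sym (⟨⟩-+ v g _)))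

    wedge-balanced : ∀ (G : Fin n → Vec A m → Carrier) f → (∀ c → Balanced λ i → G i c) →
                     ∀ c → Balanced λ i → wedge (G i) f c
    wedge-balanced {m = zero}  G f b (x ∷ c) = balanced-scale (f x) (b c)
    wedge-balanced {m = suc m} G f b (x ∷ c) =
      balanced-difference (balanced-scale (f x) (b c))
                 (wedge-balanced (λ i c′ → G i (x ∷ c′)) f (λ c′ → b (x ∷ c′)) c)

    -- The determinant is linear in its first column, so as a function of `i` it is a linear
    -- combination of the rows `φ a`.
    detForm-balanced : ∀ m (φ : Fin (suc m) → Fin n → Carrier) → (∀ a → Balanced (φ a)) →
                       ∀ c → Balanced λ i → detForm (suc m) φ (i ∷ c)
    detForm-balanced zero    φ b [] = balanced-cong (λ i → *-comm _ _) (balanced-scale 1# (b zero))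
    detForm-balanced (suc m) φ b c  = balanced-difference
      (balanced-cong (λ i → *-comm _ _) (balanced-scale (detForm (suc m) (φ ∘ suc) c) (b zero)))
      (wedge-balanced (λ i c′ → detForm (suc m) (φ ∘ suc) (i ∷ c′)) (φ zero)
                      (detForm-balanced m (φ ∘ suc) (b ∘ suc)) c)

module _ {a ℓ₁ ℓ₂} (ℝ : Reals a ℓ₁ ℓ₂) where
  open Reals ℝ hiding (zero) renaming (_<_ to _<ᵣ_; _≤_ to _≤ᵣ_)
  open CommutativeRing commutativeRing using (semiring; +-group; +-commutativeMonoid)
  open IsStrictPartialOrder <-isStrictPartialOrder using ()
    renaming (irrefl to <ᵣ-irrefl; trans to <ᵣ-trans; asym to <ᵣ-asym; <-respˡ-≈ to <ᵣ-respˡ; <-respʳ-≈ to <ᵣ-respʳ)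
  open ExteriorAlgebra commutativeRing
  open Summation +-commutativeMonoid using (sum-cong-≋; ∑-comm)
  open SemiringSummation semiring using (*-distribʳ-sum)
  open GroupProperties +-group using () renaming (ε⁻¹≈ε to -0≈0)
  open SetoidReasoning setoid

  private
    variable
      d m n r : ℕ

  -- Constructive order arithmetic and nonnegative sums.

  <⇒# : ∀ {x y} → x <ᵣ y → x # y
  <⇒# x<y = Equivalence.from #⇔<⊎> (inj₁ x<y)

  ≤-antisym : ∀ {x y} → x ≤ᵣ y → y ≤ᵣ x → x ≈ y
  ≤-antisym {x} {y} x≤y y≤x = proj₁ (tight x y) λ x#y → [ y≤x , x≤y ]′ (Equivalence.to #⇔<⊎> x#y)

  -- As `≤ᵣ` is a negation, transitivity comes from cotransitivity of apartness: `z < x` separates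
  -- `y` from one of the two.
  ≤-trans : ∀ {x y z} → x ≤ᵣ y → y ≤ᵣ z → x ≤ᵣ z
  ≤-trans {x} {y} {z} x≤y y≤z z<x with #-cotrans (<⇒# z<x) y
  ... | inj₁ z#y = [ y≤z , (λ y<z → x≤y (<ᵣ-trans y<z z<x)) ]′ (Equivalence.to #⇔<⊎> z#y)
  ... | inj₂ y#x = [ x≤y , (λ x<y → y≤z (<ᵣ-trans z<x x<y)) ]′ (Equivalence.to #⇔<⊎> y#x)

  ≤-respʳ : ∀ {x y y′} → y ≈ y′ → x ≤ᵣ y → x ≤ᵣ y′
  ≤-respʳ y≈y′ x≤y y′<x = x≤y (<ᵣ-respˡ (sym y≈y′) y′<x)

  ≈⇒≤ : ∀ {x y} → x ≈ y → x ≤ᵣ y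
  ≈⇒≤ x≈y = <ᵣ-irrefl (sym x≈y)

  x≤x+y : ∀ {x y} → 0# ≤ᵣ y → x ≤ᵣ x + y
  x≤x+y {x} {y} 0≤y x+y<x = 0≤y (<ᵣ-respˡ cancel (<ᵣ-respʳ (-‿inverseʳ x) (+-monoˡ-< (- x) x+y<x)))
    where
    cancel : x + y - x ≈ y
    cancel = begin
      x + y - x   ≈⟨ +-congʳ (+-comm x y) ⟩
      y + x - x   ≈⟨ +-assoc y x (- x) ⟩
      y + (x - x) ≈⟨ +-congˡ (-‿inverseʳ x) ⟩
      y + 0#      ≈⟨ +-identityʳ y ⟩
      y           ∎

  0<-x : ∀ {x} → x <ᵣ 0# → 0# <ᵣ - x
  0<-x {x} x<0 = <ᵣ-respˡ (-‿inverseʳ x) (<ᵣ-respʳ (+-identityˡ (- x)) (+-monoˡ-< (- x) x<0))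

  x≈-x⇒x≈0 : ∀ {x} → x ≈ - x → x ≈ 0#
  x≈-x⇒x≈0 {x} x≈-x = ≤-antisym 0≮x x≮0
    where
    x≮0 : ¬ x <ᵣ 0#
    x≮0 x<0 = <ᵣ-asym x<0 (<ᵣ-respʳ (sym x≈-x) (0<-x x<0))
    0≮x : ¬ 0# <ᵣ x
    0≮x 0<x = <ᵣ-asym 0<x (<ᵣ-respˡ (+-identityˡ x) (<ᵣ-respʳ (-‿inverseˡ x)
      (+-monoˡ-< x (<ᵣ-respʳ x≈-x 0<x))))

  -- The sign of `x` is not decidable, but a negative product excludes `0 < x`; hence `x ≈ 0`, and
  -- the product is zero after all.
  *-nonNeg : ∀ {x y} → 0# ≤ᵣ x → 0# <ᵣ y → 0# ≤ᵣ x * y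
  *-nonNeg {x} {y} 0≤x 0<y xy<0 = <ᵣ-irrefl (trans (*-congʳ x≈0) (zeroˡ y)) xy<0
    where
    x≈0 : x ≈ 0#
    x≈0 = ≤-antisym (λ 0<x → <ᵣ-asym xy<0 (*-pos 0<x 0<y)) 0≤x

  x*y≈0⇒x≈0 : ∀ {x y} → y # 0# → x * y ≈ 0# → x ≈ 0#
  x*y≈0⇒x≈0 {x} y#0 xy≈0 = proj₁ (tight x 0#) λ x#0 →
    #-irrefl xy≈0 (x#0y#0→xy#0 heytingCommutativeRing x#0 y#0)

  sum-nonNeg : (f : Fin n → Carrier) → (∀ i → 0# ≤ᵣ f i) → 0# ≤ᵣ sum f
  sum-nonNeg {zero}  f 0≤f = ≈⇒≤ refl
  sum-nonNeg {suc n} f 0≤f = ≤-trans (0≤f zero) (x≤x+y (sum-nonNeg (f ∘ suc) (0≤f ∘ suc)))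

  sum≈0⇒≈0 : (f : Fin n → Carrier) → (∀ i → 0# ≤ᵣ f i) → sum f ≈ 0# → ∀ i → f i ≈ 0#
  sum≈0⇒≈0 {suc n} f 0≤f sum≈0 = λ
    { zero    → f₀≈0
    ; (suc i) → sum≈0⇒≈0 (f ∘ suc) (0≤f ∘ suc)
                  (trans (sym (+-identityˡ _)) (trans (+-congʳ (sym f₀≈0)) sum≈0)) i }
    where
    f₀≈0 : f zero ≈ 0#
    f₀≈0 = ≤-antisym (≤-respʳ sum≈0 (x≤x+y (sum-nonNeg (f ∘ suc) (0≤f ∘ suc)))) (0≤f zero)

  ⟨⟩≈0 : (w g : Fin n → Carrier) → (∀ i → w i ≈ 0# ⊎ g i ≈ 0#) → ⟨ w , g ⟩ ≈ 0#
  ⟨⟩≈0 w g vanish = sum-zero _ λ i →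
    [ (λ w≈0 → trans (*-congʳ w≈0) (zeroˡ _)) , (λ g≈0 → trans (*-congˡ g≈0) (zeroʳ _)) ]′ (vanish i)

  -- A vanishing sum of nonnegative terms vanishes termwise, and a positive `g i` can be cancelled.
  nonNeg-support : (v g : Fin n → Carrier) → (∀ i → 0# ≤ᵣ v i) → (∀ i → g i ≈ 0# ⊎ 0# <ᵣ g i) →
                   ⟨ v , g ⟩ ≈ 0# → ∀ {i} → 0# <ᵣ g i → v i ≈ 0#
  nonNeg-support v g 0≤v side vg≈0 {i} 0<g =
    x*y≈0⇒x≈0 (Equivalence.from #⇔<⊎> (inj₂ 0<g))
              (sum≈0⇒≈0 (λ i → v i * g i) 0≤vg vg≈0 i)
    where
    0≤vg : ∀ i → 0# ≤ᵣ v i * g i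
    0≤vg i = [ (λ g≈0 → ≈⇒≤ (sym (trans (*-congˡ g≈0) (zeroʳ _)))) , *-nonNeg (0≤v i) ]′ (side i)

  -- Orientations and convex hulls in terms of forms.

  det≈detForm : ∀ m {M : Fin m → Fin m → Carrier} {A : Set} (φ : Fin m → A → Carrier) (c : Fin m → A) →
                (∀ a b → M a b ≈ φ a (c b)) → det ℝ m M ≈ detForm m φ (tabulate c)
  det≈detForm zero    φ c M≈ = refl
  det≈detForm (suc m) φ c M≈ = trans
    -- Deleting column `j` of the matrix deletes one label from `c`, so the minors have the same
    -- form again.
    (sum-cong-≋ λ j → *-congˡ {x = (- 1#) ^ toℕ j} (*-cong (M≈ zero j)
      (det≈detForm m (φ ∘ suc) (c ∘ punchIn j) λ a b → M≈ (suc a) (punchIn j b))))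
    (sym (wedge-expand (detForm m (φ ∘ suc)) (φ zero) c))

  homogeneousCoordinate : (Fin n → Point ℝ d) → Fin (suc d) → Fin n → Carrier
  homogeneousCoordinate x zero    i = 1#
  homogeneousCoordinate x (suc a) i = x i a

  orientation≈detForm : (x : Fin n → Point ℝ d) (κ : Fin (suc d) → Fin n) →
    orientation ℝ (x ∘ κ) ≈ detForm (suc d) (homogeneousCoordinate x) (tabulate κ)
  orientation≈detForm {d = d} x κ = det≈detForm (suc d) {orientationMatrix ℝ (x ∘ κ)} (homogeneousCoordinate x) κ λ
    { zero b → refl ; (suc a) b → refl }

  -- Equal total weights balance the constant row; the common point `z` balances the coordinate
  -- rows.
  hull-balanced : (x : Fin n → Point ℝ d) {S T : Subset n} {z : Point ℝ d} →
    (p : InConv ℝ x S z) (q : InConv ℝ x T z) →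
    ∀ a → Balanced (proj₁ p) (proj₁ q) (homogeneousCoordinate x a)
  hull-balanced x (u , _ , _ , ∑u , _) (v , _ , _ , ∑v , _) zero = begin
    ⟨ u , (λ _ → 1#) ⟩  ≈⟨ sum-cong-≋ (λ i → *-identityʳ (u i)) ⟩
    sum u               ≈⟨ ∑u ⟩
    1#                  ≈⟨ ∑v ⟨
    sum v               ≈⟨ sum-cong-≋ (λ i → *-identityʳ (v i)) ⟨
    ⟨ v , (λ _ → 1#) ⟩  ∎
  hull-balanced x (u , _ , _ , _ , z≈u) (v , _ , _ , _ , z≈v) (suc a) = trans (sym (z≈u a)) (z≈v a)

  -- Weights vanishing on `S` vanish everywhere, against their total `1#`. In particular an empty
  -- set has an empty hull.
  hull-nonEmpty : (x : Fin n → Point ℝ d) {S : Subset n} {z : Point ℝ d} (p : InConv ℝ x S z) →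
                  ¬ (∀ {i} → i ∈ S → proj₁ p i ≈ 0#)
  hull-nonEmpty x {S} (w , _ , supp , ∑w , _) w≈0 =
    #-irrefl (trans (sym ∑w) (sum-zero w all≈0)) (1#0 heytingCommutativeRing)
    where
    all≈0 : ∀ i → w i ≈ 0#
    all≈0 i with i ∈? S
    ... | yes i∈S = w≈0 i∈S
    ... | no  i∉S = supp i i∉S

  -- Neighborliness of order-type homogeneous sets.

  module _ (x : Fin n → Point ℝ d) (homog : OrderTypeHomogeneous ℝ x) where

    private
      D : Vec (Fin n) (suc d) → Carrier
      D = detForm (suc d) (homogeneousCoordinate x)

      D-antisymmetric : Antisymmetric D
      D-antisymmetric = detForm-antisymmetric (suc d) (homogeneousCoordinate x)

    D#0 : ∀ {κ} → StrictlyIncreasing κ → D (tabulate κ) # 0#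
    D#0 {κ} inc with proj₂ homog
    ... | inj₁ pos = Equivalence.from #⇔<⊎> (inj₂ (<ᵣ-respʳ (orientation≈detForm x κ) (pos κ inc)))
    ... | inj₂ neg = Equivalence.from #⇔<⊎> (inj₁ (<ᵣ-respˡ (orientation≈detForm x κ) (neg κ inc)))

    D-insertion : ∀ {ι i} (e : EvenInsertion ι i) → D (i ∷ tabulate ι) ≈ D (tabulate (EvenInsertion.κ e))
    D-insertion {ι} {i} e = begin
      D (i ∷ tabulate ι)
        ≡⟨ ≡.cong₂ (λ j c → D (j ∷ c)) inserted (tabulate-cong remaining) ⟨
      D (κ position ∷ tabulate (κ ∘ punchIn position))
        ≈⟨ moveToFront D-antisymmetric κ position ⟩
      (- 1#) ^ toℕ position * D (tabulate κ)
        ≡⟨ ≡.cong (λ k → (- 1#) ^ k * D (tabulate κ)) even ⟩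
      (- 1#) ^ (half ℕ.+ half) * D (tabulate κ)
        ≈⟨ *-congʳ (-1^even≈1 half) ⟩
      1# * D (tabulate κ)
        ≈⟨ *-identityˡ _ ⟩
      D (tabulate κ) ∎
      where open EvenInsertion e

    D-repeated : ∀ c j → D (c j ∷ tabulate c) ≈ 0#
    D-repeated = repeated x≈-x⇒x≈0 D-antisymmetric

    -- As a function of `i`, `D (i ∷ tabulate ι)` is an affine functional that vanishes on the facet
    -- and, by even insertion, has the common orientation sign at all other points. Nonnegative
    -- weights pairing to zero with it have no mass off the facet.
    facet-support : {ι : Fin d → Fin n} → (∀ i → InImage ι i ⊎ EvenInsertion ι i) →
      (v : Fin n → Carrier) → (∀ i → 0# ≤ᵣ v i) → ⟨ v , (λ i → D (i ∷ tabulate ι)) ⟩ ≈ 0# →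
      ∀ {i} → EvenInsertion ι i → v i ≈ 0#
    facet-support {ι} evenly v 0≤v vg≈0 ins with proj₂ homog
    ... | inj₁ pos = nonNeg-support v g 0≤v side vg≈0 (0<g ins)
      where
      g : Fin n → Carrier
      g i = D (i ∷ tabulate ι)
      0<g : ∀ {i} → EvenInsertion ι i → 0# <ᵣ g i
      0<g e = <ᵣ-respʳ (trans (orientation≈detForm x κ) (sym (D-insertion e))) (pos κ increasing)
        where open EvenInsertion e
      side : ∀ i → g i ≈ 0# ⊎ 0# <ᵣ g i
      side i with evenly i
      ... | inj₁ (j , ≡.refl) = inj₁ (D-repeated ι j)
      ... | inj₂ e            = inj₂ (0<g e)
    -- For negative orientation the functional is negated first.
    ... | inj₂ neg = nonNeg-support v g 0≤v side (trans (⟨⟩-neg v _) (trans (-‿cong vg≈0) -0≈0)) (0<g ins)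
      where
      g : Fin n → Carrier
      g i = - D (i ∷ tabulate ι)
      0<g : ∀ {i} → EvenInsertion ι i → 0# <ᵣ g i
      0<g e = 0<-x (<ᵣ-respˡ (trans (orientation≈detForm x κ) (sym (D-insertion e))) (neg κ increasing))
        where open EvenInsertion e
      side : ∀ i → g i ≈ 0# ⊎ 0# <ᵣ g i
      side i with evenly i
      ... | inj₁ (j , ≡.refl) = inj₁ (trans (-‿cong (D-repeated ι j)) -0≈0)
      ... | inj₂ e            = inj₂ (0<g e)

    -- The weights `v` are first confined to a facet covering `S`; then `u` is shown to vanish at
    -- each index of `S`, against its total weight.
    neighborly : d < n → {S T : Subset n} {z : Point ℝ d} → ∣ S ∣ ℕ.+ ∣ S ∣ ≤ d →
      (∀ {i} → i ∈ S → i ∉ T) → InConv ℝ x S z → ¬ InConv ℝ x T z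
    neighborly d<n {S} {T} 2∣S∣≤d disjoint p@(u , 0≤u , suppU , _) q@(v , 0≤v , suppV , _) =
      hull-nonEmpty x p u≈0
      where
      open GaleFacet (galeFacet d S 2∣S∣≤d (ℕₚ.<⇒≤ d<n)) hiding (increasing)
      -- An index off the facet exists because `d < n`; with it, `κ` lists `d + 1` points of nonzero
      -- orientation.
      open EvenInsertion (proj₂ (spare d<n))

      balanced : ∀ c → Balanced u v λ i → D (i ∷ c)
      balanced = detForm-balanced u v d (homogeneousCoordinate x) (hull-balanced x p q)

      v≈0 : ∀ {i} → EvenInsertion ι i → v i ≈ 0#
      -- `u` lives on `S`, where the facet functional vanishes; balance carries the zero pairing
      -- over to `v`.
      v≈0 = facet-support evenly v 0≤v (trans (sym (balanced (tabulate ι))) (⟨⟩≈0 u _ vanish))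
        where
        vanish : ∀ i → u i ≈ 0# ⊎ D (i ∷ tabulate ι) ≈ 0#
        vanish i with i ∈? S
        ... | no  i∉S = inj₁ (suppU i i∉S)
        ... | yes i∈S with covers i∈S
        ...   | j , ≡.refl = inj₂ (D-repeated ι j)

      ι⊆κ : ∀ {i} → InImage ι i → InImage κ i
      ι⊆κ (j , ιj≡i) = punchIn position j , ≡.trans (remaining j) ιj≡i

      -- The functional vanishing on every κ-point except κ s isolates u (κ s).
      module _ (s : Fin (suc d)) (κs∈S : κ s ∈ S) where
        g : Fin n → Carrier
        g i = D (i ∷ tabulate (κ ∘ punchIn s))

        g≈0 : ∀ {i} → InImage κ i → i ≢ κ s → g i ≈ 0#
        g≈0 (j , ≡.refl) κj≢κs = ≡.subst (λ t → g (κ t) ≈ 0#) (Finₚ.punchIn-punchOut s≢j)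
                                   (D-repeated (κ ∘ punchIn s) (punchOut s≢j))
          where
          s≢j : s ≢ j
          s≢j s≡j = κj≢κs (≡.cong κ (≡.sym s≡j))

        vg≈0 : ⟨ v , g ⟩ ≈ 0#
        vg≈0 = ⟨⟩≈0 v g vanish
          where
          vanish : ∀ i → v i ≈ 0# ⊎ g i ≈ 0#
          -- At `κ s` the weight is zero by disjointness, on the rest of the facet `g` vanishes, and
          -- off the facet `v` does.
          vanish i with i Fin.≟ κ s
          ... | yes ≡.refl = inj₁ (suppV i (disjoint κs∈S))
          ... | no  i≢κs with evenly i
          ...   | inj₁ i∈ι = inj₂ (g≈0 (ι⊆κ i∈ι) i≢κs)
          ...   | inj₂ e   = inj₁ (v≈0 e)

        ug≈u*g : ⟨ u , g ⟩ ≈ u (κ s) * g (κ s)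
        ug≈u*g = sum-single _ (κ s) vanish
          where
          vanish : ∀ i → i ≢ κ s → u i * g i ≈ 0#
          vanish i i≢κs with i ∈? S
          ... | yes i∈S = trans (*-congˡ (g≈0 (ι⊆κ (covers i∈S)) i≢κs)) (zeroʳ _)
          ... | no  i∉S = trans (*-congʳ (suppU i i∉S)) (zeroˡ _)

        u*-1^s≈0 : u (κ s) * (- 1#) ^ toℕ s ≈ 0#
        -- Up to sign `g (κ s)` is `D (tabulate κ)`, which is apart from zero and can be cancelled;
        -- the sign is cancelled afterwards.
        u*-1^s≈0 = x*y≈0⇒x≈0 (D#0 increasing) (begin
          u (κ s) * (- 1#) ^ toℕ s * D (tabulate κ)    ≈⟨ *-assoc _ _ _ ⟩
          u (κ s) * ((- 1#) ^ toℕ s * D (tabulate κ))  ≈⟨ *-congˡ (moveToFront D-antisymmetric κ s) ⟨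
          u (κ s) * g (κ s)                            ≈⟨ ug≈u*g ⟨
          ⟨ u , g ⟩                                    ≈⟨ balanced _ ⟩
          ⟨ v , g ⟩                                    ≈⟨ vg≈0 ⟩
          0#                                           ∎)

        uκs≈0 : u (κ s) ≈ 0#
        uκs≈0 = x*y≈0⇒x≈0 (-1^#0 (toℕ s)) u*-1^s≈0
          where
          -1#0 : (- 1#) # 0#
          -- The apartness of `1#` and `0#` gives an order in one direction or the other;
          -- translating by `- 1#` settles both.
          -1#0 with Equivalence.to #⇔<⊎> (1#0 heytingCommutativeRing)
          ... | inj₁ 1<0 = Equivalence.from #⇔<⊎> (inj₂ (0<-x 1<0))
          ... | inj₂ 0<1 = <⇒# (<ᵣ-respʳ (-‿inverseʳ 1#) (<ᵣ-respˡ (+-identityˡ _) (+-monoˡ-< (- 1#) 0<1)))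
          -1^#0 : ∀ k → ((- 1#) ^ k) # 0#
          -1^#0 zero    = 1#0 heytingCommutativeRing
          -1^#0 (suc k) = x#0y#0→xy#0 heytingCommutativeRing -1#0 (-1^#0 k)

      u≈0 : ∀ {i} → i ∈ S → u i ≈ 0#
      u≈0 i∈S with ι⊆κ (covers i∈S)
      ... | s , ≡.refl = uκs≈0 s i∈S

  -- Transport of convex combinations along index maps.

  pushforward : (Fin m → Fin n) → (Fin m → Carrier) → Fin n → Carrier
  pushforward e w k = sum λ j → if does (e j Fin.≟ k) then w j else 0#

  -- Change of variables: once the sums are exchanged, the inner one collapses to the term
  -- `k = e j`.
  ⟨pushforward,⟩ : ∀ (e : Fin m → Fin n) w g → ⟨ pushforward e w , g ⟩ ≈ ⟨ w , g ∘ e ⟩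
  ⟨pushforward,⟩ {m} {n} e w g = begin
    sum (λ k → pushforward e w k * g k)     ≈⟨ sum-cong-≋ (λ k → *-distribʳ-sum (g k) (λ j → δ j k)) ⟩
    sum (λ k → sum (λ j → δ j k * g k))     ≈⟨ ∑-comm (λ k j → δ j k * g k) ⟩
    sum (λ j → sum (λ k → δ j k * g k))     ≈⟨ sum-cong-≋ (λ j → sum-single (λ k → δ j k * g k) (e j) (off j)) ⟩
    sum (λ j → δ j (e j) * g (e j))         ≈⟨ sum-cong-≋ (λ j → *-congʳ (on j)) ⟩
    sum (λ j → w j * g (e j))               ∎
    where
    δ : Fin m → Fin n → Carrier
    δ j k = if does (e j Fin.≟ k) then w j else 0#
    on : ∀ j → δ j (e j) ≈ w j
    on j with e j Fin.≟ e j
    ... | yes _  = refl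
    ... | no  ≢ = contradiction ≡.refl ≢
    off : ∀ j k → k ≢ e j → δ j k * g k ≈ 0#
    off j k k≢ with e j Fin.≟ k
    ... | yes ≡ = contradiction (≡.sym ≡) k≢
    ... | no  _ = zeroˡ _

  inConv-pushforward : (x : Fin n → Point ℝ d) (e : Fin m → Fin n) {S : Subset m} {S′ : Subset n}
    {z : Point ℝ d} → (∀ {j} → j ∈ S → e j ∈ S′) → InConv ℝ (x ∘ e) S z → InConv ℝ x S′ z
  inConv-pushforward {n} {d} {m} x e {S} {S′} {z} e∈ (w , 0≤w , supp , ∑w , z≈) =
    pushforward e w , (λ k → sum-nonNeg _ (nonNeg k)) , (λ k k∉ → sum-zero _ (support k k∉)) , total ,
    λ a → trans (z≈ a) (sym (⟨pushforward,⟩ e w (λ k → x k a)))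
    where
    nonNeg : ∀ k j → 0# ≤ᵣ (if does (e j Fin.≟ k) then w j else 0#)
    nonNeg k j with e j Fin.≟ k
    ... | yes _ = 0≤w j
    ... | no  _ = ≈⇒≤ refl
    support : ∀ k → k ∉ S′ → ∀ j → (if does (e j Fin.≟ k) then w j else 0#) ≈ 0#
    support k k∉ j with e j Fin.≟ k
    ... | yes ≡.refl = supp j (k∉ ∘ e∈)
    ... | no  _      = refl
    total : sum (pushforward e w) ≈ 1#
    total = begin
      sum (pushforward e w)              ≈⟨ sum-cong-≋ (λ k → *-identityʳ (pushforward e w k)) ⟨
      ⟨ pushforward e w , (λ _ → 1#) ⟩   ≈⟨ ⟨pushforward,⟩ e w (λ _ → 1#) ⟩
      ⟨ w , (λ _ → 1#) ⟩                 ≈⟨ sum-cong-≋ (λ j → *-identityʳ (w j)) ⟩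
      sum w                              ≈⟨ ∑w ⟩
      1#                                 ∎

  homogeneous-subsequence : (x : Fin n → Point ℝ d) {e : Fin m → Fin n} → StrictlyIncreasing e →
    OrderTypeHomogeneous ℝ x → OrderTypeHomogeneous ℝ (x ∘ e)
  homogeneous-subsequence x {e} inc (injective , orient) =
    (λ same → increasing⇒injective inc (injective same)) ,
    [ (λ pos → inj₁ λ ι ι-inc → pos (e ∘ ι) (λ a<b → inc (ι-inc a<b)))
    , (λ neg → inj₂ λ ι ι-inc → neg (e ∘ ι) (λ a<b → inc (ι-inc a<b))) ]′ orient

  -- The two tolerance bounds.

  alternating-tolerates : ∀ d r n c .{{_ : NonZero r}} → GuaranteesAlternating ℝ d r c →
    (x : Fin n → Point ℝ d) → OrderTypeHomogeneous ℝ x → Tolerates ℝ x r (+ (n / r) ℤ.- + c)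
  alternating-tolerates d r n c guarantee x homog = alternating n r , λ Y ∣Y∣≤ → hulls Y (bound Y ∣Y∣≤)
    where
    bound : ∀ (Y : Subset n) → + ∣ Y ∣ ℤ.≤ + (n / r) ℤ.- + c → ∣ Y ∣ ℕ.+ c ≤ n / r
    -- The difference in ℤ is not truncated: for `n / r < c` it is negative and no `Y` meets the
    -- premise.
    bound Y ∣Y∣≤ = ℤₚ.drop‿+≤+ (≡.subst (+ ∣ Y ∣ ℤ.+ + c ℤ.≤_) cancel (ℤₚ.+-monoˡ-≤ (+ c) ∣Y∣≤))
      where
      cancel : + (n / r) ℤ.- + c ℤ.+ + c ≡ + (n / r)
      cancel = ≡.trans (ℤₚ.+-assoc (+ (n / r)) (ℤ.- + c) (+ c))
        (≡.trans (≡.cong (ℤ._+_ (+ (n / r))) (ℤₚ.+-inverseˡ (+ c))) (ℤₚ.+-identityʳ _))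

    hulls : ∀ Y → ∣ Y ∣ ℕ.+ c ≤ n / r → HullsIntersect ℝ x (λ i → part (alternating n r) i ─ Y)
    hulls Y ∣Y∣+c≤ =
      let z , inHull = guarantee (blocks ℕ.* r) (x ∘ e) (homogeneous-subsequence x increasing homog) c≤
      in z , λ i → inConv-pushforward x e (e∈ i) (inHull i)
      where
      open AlignedAvoiding (alignedAvoiding r (n / r) Y (m/n*n≤m n r))
      c≤ : c ≤ blocks ℕ.* r
      -- At least `c` blocks survive, and each has `r ≥ 1` points, so at least `c` points remain.
      c≤ = ℕₚ.≤-trans
        (ℕₚ.+-cancelˡ-≤ ∣ Y ∣ c blocks
          (ℕₚ.≤-trans ∣Y∣+c≤ (ℕₚ.≤-trans enough (ℕₚ.≤-reflexive (ℕₚ.+-comm blocks ∣ Y ∣)))))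
        (ℕₚ.m≤m*n blocks r)
      e∈ : ∀ i {j} → j ∈ part (alternating (blocks ℕ.* r) r) i → e j ∈ part (alternating n r) i ─ Y
      e∈ i {j} j∈ = ∈-─⁺
        (∈-part⁺ (alternating n r) (≡.trans (alternating-aligned r (aligned j)) (∈-part⁻ (alternating _ r) j∈)))
        (avoids j)

  tolerance-bound : ∀ d r n .{{_ : NonZero r}} (x : Fin n → Point ℝ d) → OrderTypeHomogeneous ℝ x →
    d ≤ 3 ⊎ (2 ≤ r × d < n) → ∀ t → Tolerates ℝ x r (+ t) → t ℕ.+ ⌊ d /2⌋ ≤ n / r
  tolerance-bound d r n x homog cases t (f , tolerates) = ℕₚ.≮⇒≥ λ n/r< → impossible n/r< cases
    where
    k : Fin r
    k = proj₁ (smallPart n r f)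

    impossible : n / r < t ℕ.+ ⌊ d /2⌋ → ¬ (d ≤ 3 ⊎ (2 ≤ r × d < n))
    -- Here `⌊ d /2⌋ ≤ 1`, so the small part has at most `t` points and can be deleted entirely.
    impossible n/r< (inj₁ d≤3) =
      let Y , ∣Y∣≤t , ∣A─Y∣≤0 = discard {m = 0} t (part f k) ∣A∣≤t
          z , inHull          = tolerates Y (ℤ.+≤+ ∣Y∣≤t)
      in hull-nonEmpty x (inHull k) λ {i} i∈ → ⊥-elim (∣p∣≡0⇒∉ _ (ℕₚ.n≤0⇒n≡0 ∣A─Y∣≤0) i i∈)
      where
      ∣A∣≤t : ∣ part f k ∣ ≤ t ℕ.+ 0
      ∣A∣≤t = ℕ.s≤s⁻¹ (ℕₚ.≤-trans (s≤s (proj₂ (smallPart n r f)))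
        (ℕₚ.≤-trans n/r< (ℕₚ.≤-trans (ℕₚ.+-monoʳ-≤ t (ℕₚ.⌊n/2⌋-mono d≤3)) (ℕₚ.≤-reflexive (ℕₚ.+-suc t 0)))))
    -- After `t` deletions at most `⌊ d /2⌋` points of part `k` remain. A second part exists by
    -- `2 ≤ r`, and it is disjoint from the first because `f` assigns one label to each point.
    impossible n/r< (inj₂ (2≤r , d<n)) =
      let Y , ∣Y∣≤t , ∣A─Y∣≤ = discard {m = ⌊ d /2⌋} t (part f k)
                                 (ℕₚ.≤-trans (proj₂ (smallPart n r f)) (ℕₚ.<⇒≤ n/r<))
          z , inHull         = tolerates Y (ℤ.+≤+ ∣Y∣≤t)
          k′ , k′≢k          = other 2≤r k
      in neighborly x homog d<n
           (ℕₚ.≤-trans (ℕₚ.+-mono-≤ ∣A─Y∣≤ (ℕₚ.≤-trans ∣A─Y∣≤ (ℕₚ.⌊n/2⌋≤⌈n/2⌉ d)))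
                       (ℕₚ.≤-reflexive (ℕₚ.⌊n/2⌋+⌈n/2⌉≡n d)))
           (λ i∈ i∈′ → k′≢k (≡.trans (≡.sym (∈-part⁻ f (p─q⊆p _ Y i∈′))) (∈-part⁻ f (p─q⊆p _ Y i∈))))
           (inHull k) (inHull k′)
      where
      other : ∀ {r} → 2 ≤ r → (k : Fin r) → ∃[ k′ ] k′ ≢ k
      other (s≤s (s≤s _)) zero    = suc zero , λ ()
      other (s≤s (s≤s _)) (suc _) = zero , λ ()

-- The lower bound is the maximality of `t`. The premises of the upper bound exclude degenerate
-- cases. For `r = 1` a nonempty set has tolerance `n - 1`, too large once `d ≥ 4`. Three collinear
-- points in dimension 4 with `r = 2` have tolerance 0 against `1 - 2`. Seven homogeneous points in
-- dimension 6 with `r = 7` have the value -1 against `1 - 3`.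
theorem3p4 : ∀ {a ℓ₁ ℓ₂} (ℝ : Reals a ℓ₁ ℓ₂) (d r n c : ℕ) .{{_ : NonZero r}} →
    GuaranteesAlternating ℝ d r c →
    (x : Fin n → Point ℝ d) → OrderTypeHomogeneous ℝ x →
    (t : ℤ) → IsTolerance ℝ x r t →
    (+ (n / r) ℤ.- + c ℤ.≤ t)
    × (d ≤ 3 ⊎ (2 ≤ r × d < n) → + 0 ℤ.≤ t → t ℤ.≤ + (n / r) ℤ.- + ⌊ d /2⌋)
theorem3p4 ℝ d r n c guarantee x homog t (tolerates , maximal) =
  maximal _ (alternating-tolerates ℝ d r n c guarantee x homog) , upper t tolerates
  where
  upper : ∀ t → Tolerates ℝ x r t → d ≤ 3 ⊎ (2 ≤ r × d < n) → + 0 ℤ.≤ t → t ℤ.≤ + (n / r) ℤ.- + ⌊ d /2⌋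
  upper (+ t) tol cases _ = ≡.subst (ℤ._≤ + (n / r) ℤ.- + k) cancel
    (ℤₚ.+-monoˡ-≤ (ℤ.- + k) (ℤ.+≤+ (tolerance-bound ℝ d r n x homog cases t tol)))
    where
    k = ⌊ d /2⌋
    cancel : + (t ℕ.+ k) ℤ.- + k ≡ + t
    cancel = ≡.trans (ℤₚ.+-assoc (+ t) (+ k) (ℤ.- + k))
      (≡.trans (≡.cong (ℤ._+_ (+ t)) (ℤₚ.+-inverseʳ (+ k))) (ℤₚ.+-identityʳ _))
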